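{- Let $n\ge 1$, let $a=(a_1,\ldots,a_n)$ and $b=(b_1,\ldots,b_n)$ be two $n$-tuples of positive integers, and let $X$ be a non-empty subset of $\mathbb{N}\setminus\{0\}$. Then the following conditions are equivalent. 1. $\mathcal{N}(a,b,X)$ is finite. 2. $M(a,b,X)$ is a numerical semigroup. 3. $\gcd(X\cup\{b_1,\ldots,b_n\})=1$.
   Context: $\mathbb{N}$ is the set of non-negative integers. A numerical semigroup is a submonoid $S$ of $(\mathbb{N},+)$ with $\mathbb{N}\setminus S$ finite. For $s\in\mathbb{N}$, $as+b=(a_1s+b_1,\ldots,a_ns+b_n)$. $\mathcal{N}(a,b,X)$ is the set of all numerical semigroups $S$ such that $X\subseteq S$ and $as+b\in S^n$ for all $s\in S\setminus\{0\}$. $M(a,b,X)=\bigcap_{S\in\mathcal{N}(a,b,X)}S$. For a (possibly infinite) set $A$ of integers, $\gcd(A)$ is the greatest common divisor of the elements of $A$. -}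

module Defs where

open import Data.List.Base using (List)
open import Data.List.Relation.Unary.Enumerates.Setoid using (IsEnumeration)
open import Data.Nat.Base using (ℕ; _+_; _*_)
open import Data.Nat.Divisibility using (_∣_)
open import Data.Product.Base using (∃; proj₁)
open import Data.Vec.Functional using (Vector)
open import Data.Vec.Functional.Relation.Unary.All using (All)
open import Data.Vec.Functional.Relation.Unary.Any using (Any)
open import Level using (Level; _⊔_; 0ℓ) renaming (suc to lsuc)
open import Relation.Binary.Bundles using (Setoid)
import Relation.Binary.Construct.On as On
open import Relation.Binary.PropositionalEquality using (_≡_; setoid)
open import Relation.Unary
  using (Pred; _∈_; _⊆_; ∁; _∖_; ｛_｝; ⋂)
open import Relation.Unary.Relation.Binary.Equality using (≐-setoid)

private
  variable
    c ℓ p : Level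
    n : ℕ

-- The elements of P are compared by the equality of A alone: the proofs of
-- membership in P are ignored.
Finite : (A : Setoid c ℓ) → Pred (Setoid.Carrier A) p → Set (c ⊔ ℓ ⊔ p)
Finite A P = ∃ λ (xs : List (∃ P)) → IsEnumeration (On.setoid A proj₁) xs

record IsSubmonoid (S : Pred ℕ p) : Set p where
  field
    0∈S      : 0 ∈ S
    +-closed : ∀ {x y} → x ∈ S → y ∈ S → x + y ∈ S

record IsNumericalSemigroup (S : Pred ℕ p) : Set p where
  field
    isSubmonoid      : IsSubmonoid S
    finiteComplement : Finite (setoid ℕ) (∁ S)

affine : Vector ℕ n → Vector ℕ n → ℕ → Vector ℕ n
affine a b s i = a i * s + b i

record 𝒩 (a b : Vector ℕ n) (X : Pred ℕ 0ℓ) (S : Pred ℕ 0ℓ) : Set where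
  field
    isNumericalSemigroup : IsNumericalSemigroup S
    X⊆S                  : X ⊆ S
    affine-closed        : ∀ s → s ∈ S ∖ ｛ 0 ｝ → All S (affine a b s)

-- The intersection ranges over a collection of subsets, so it lives one
-- universe above them.
M : Vector ℕ n → Vector ℕ n → Pred ℕ 0ℓ → Pred ℕ (lsuc 0ℓ)
M a b X = ⋂[ S ∶ ∃ (𝒩 a b X) ] proj₁ S

-- Two members of 𝒩 a b X are identified when they have the same elements.
𝒩-Finite : Vector ℕ n → Vector ℕ n → Pred ℕ 0ℓ → Set (lsuc 0ℓ)
𝒩-Finite a b X = Finite (≐-setoid ℕ 0ℓ) (𝒩 a b X)

entries : Vector ℕ n → Pred ℕ 0ℓ
entries b x = Any (x ≡_) b

-- As in Data.Nat.GCD, "greatest" refers to the divisibility order.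
record IsGCD (A : Pred ℕ p) (d : ℕ) : Set p where
  field
    commonDivisor : ∀ {x} → x ∈ A → d ∣ x
    greatest      : ∀ {e} → (∀ {x} → x ∈ A → e ∣ x) → e ∣ d

{-# OPTIONS --safe #-}
-- Call d a difference of a submonoid S when y and y + d both lie in S for some y.
-- Reducing a positive difference modulo an element of S that it does not divide
-- gives a smaller one; so if the elements of S have gcd 1, then 1 is a difference,
-- and two consecutive elements of S generate all large numbers.  For S = M a b X
-- the gcd is 1 as soon as gcd (X ∪ entries b) = 1, since a common divisor of M
-- divides x and aᵢ x + bᵢ for x ∈ X.  Conversely, if d divides X and b, then
-- d ℕ ∪ [k, ∞) belongs to 𝒩 a b X for every k, hence M ⊆ d ℕ.
module Submission where

open import Defs
open import Axiom.DoubleNegationElimination using (em⇒dne)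
open import Axiom.ExcludedMiddle using (ExcludedMiddle)
open import Data.Empty using (⊥-elim)
open import Data.Fin.Base using (Fin; zero; suc; fromℕ<; toℕ; funToFin; finToFun)
open import Data.Fin.Properties using (toℕ-fromℕ<; finToFun-funToFin)
open import Data.List.Base using (List; []; _∷_; allFin; map; upTo)
open import Data.List.Membership.Propositional using (find) renaming (_∈_ to _∈ₗ_)
open import Data.List.Membership.Propositional.Properties
  using (∈-allFin; ∈-map⁺; ∈-upTo⁺)
open import Data.List.Relation.Unary.Any as Any using (here; there)
open import Data.List.Relation.Unary.Any.Properties using (map⁺; map⁻)
open import Data.Nat.Base
  using (ℕ; zero; suc; _+_; _*_; _∸_; _^_; _≤_; _<_; _≥_; _>_; NonZero; >-nonZero)
open import Data.Nat.Divisibility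
  using (_∣_; _∣?_; 1∣_; ∣1⇒≡1; ∣m∣n⇒∣m+n; ∣m+n∣m⇒∣n; ∣n⇒∣m*n; _∣0; m%n≡0⇒n∣m)
open import Data.Nat.DivMod
  using (_/_; _%_; m≡m%n+[m/n]*n; m%n<n; m*n/n≡m; /-monoˡ-≤)
open import Data.Nat.Induction using (<-wellFounded)
open import Data.Nat.ListAction using (sum)
open import Data.Nat.Properties
open import Data.Nat.Tactic.RingSolver using (solve-∀)
open import Data.Product.Base using (∃; _×_; _,_; proj₁; proj₂)
open import Data.Sum.Base using (inj₁; inj₂)
open import Data.Vec.Functional using (Vector)
open import Data.Vec.Functional.Relation.Unary.All using (All)
open import Function.Base using (_∘_)
open import Function.Bundles using (_⇔_; mk⇔)
open import Induction.WellFounded using (Acc; acc)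
open import Level using (Level; _⊔_; 0ℓ; lift; lower) renaming (suc to lsuc)
open import Relation.Binary.Bundles using (Setoid)
open import Relation.Binary.PropositionalEquality
open import Relation.Nullary using (yes; no; ¬_; contradiction)
open import Relation.Nullary.Decidable using (map′)
open import Relation.Unary
  using (Pred; Satisfiable; _∈_; _∉_; _∪_; _⊆_; ∁; _∖_; ｛_｝)
open import Relation.Unary.Relation.Binary.Equality using (≐-setoid)

private
  variable
    c ℓ p : Level

-- Enumerating a class of objects through finitely many codes

lower-em : ExcludedMiddle (lsuc 0ℓ) → ExcludedMiddle 0ℓ
lower-em em = map′ lower lift em

-- Excluded middle decides for each listed code whether it is attained, and one preimage is kept for
-- each that is. An `x` need not itself occur in `xs`; only its code is represented.
preimages : ExcludedMiddle (c ⊔ p) → {A : Set c} {P : Pred A p} {I : Set} →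
  (code : ∃ P → I) (is : List I) →
  ∃ λ xs → ∀ x → code x ∈ₗ is → code x ∈ₗ map code xs
preimages em code [] = [] , λ _ ()
preimages em code (i ∷ is) with preimages em code is | em {∃ λ x → code x ≡ i}
... | xs , complete | yes (y , cy≡i) = y ∷ xs , λ where
  x (here cx≡i)   → here (trans cx≡i (sym cy≡i))
  x (there cx∈is) → there (complete x cx∈is)
... | xs , complete | no ∄y = xs , λ where
  x (here cx≡i)   → ⊥-elim (∄y (x , cx≡i))
  x (there cx∈is) → complete x cx∈is

injectiveCode⇒finite : ExcludedMiddle (c ⊔ p) → (A : Setoid c ℓ) →
  {P : Pred (Setoid.Carrier A) p} {I : Set} (code : ∃ P → I) →
  (∀ x y → code x ≡ code y → Setoid._≈_ A (proj₁ x) (proj₁ y)) →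
  (is : List I) → (∀ x → code x ∈ₗ is) → Finite A P
injectiveCode⇒finite em A code injective is code∈is with preimages em code is
... | xs , complete =
  xs , λ x → Any.map (injective x _) (map⁻ (complete x (code∈is x)))

-- Finite complements and thresholds

∈⇒≤sum : ∀ {x} {xs : List ℕ} → x ∈ₗ xs → x ≤ sum xs
∈⇒≤sum {xs = y ∷ ys} (here refl)  = m≤m+n y (sum ys)
∈⇒≤sum {xs = y ∷ ys} (there x∈ys) = m≤n⇒m≤o+n y (∈⇒≤sum x∈ys)

Contains≥ : Pred ℕ p → ℕ → Set p
Contains≥ S k = ∀ {x} → k ≤ x → x ∈ S

finiteComplement⇒contains≥ : ExcludedMiddle p → {S : Pred ℕ p} →
  Finite (setoid ℕ) (∁ S) → ∃ (Contains≥ S)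
finiteComplement⇒contains≥ em {S} (xs , complete) =
  -- Every gap is at most the sum of all gaps, so anything beyond that sum is not a gap.
  suc (sum (map proj₁ xs)) , λ {x} k≤x → em⇒dne em λ x∉S →
    <⇒≱ k≤x (∈⇒≤sum (map⁺ (complete (x , x∉S))))

contains≥⇒finiteComplement : ExcludedMiddle p → {S : Pred ℕ p} {k : ℕ} →
  Contains≥ S k → Finite (setoid ℕ) (∁ S)
contains≥⇒finiteComplement em {k = k} ≥k⇒∈S =
  injectiveCode⇒finite em (setoid ℕ) proj₁ (λ _ _ eq → eq) (upTo k)
    λ (x , x∉S) → ∈-upTo⁺ (≰⇒> (x∉S ∘ ≥k⇒∈S))

-- Sets that contain everything from `k` on

module _ (em : ExcludedMiddle 0ℓ) (k : ℕ) where

  bit : Pred ℕ 0ℓ → Fin k → Fin 2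
  bit S i with em {toℕ i ∈ S}
  ... | yes _ = suc zero
  ... | no  _ = zero

  bit-reflects : ∀ S T i → bit S i ≡ bit T i → toℕ i ∈ S → toℕ i ∈ T
  bit-reflects S T i eq i∈S with em {toℕ i ∈ S} | em {toℕ i ∈ T}
  ... | _      | yes i∈T = i∈T
  ... | no i∉S | no  _   = contradiction i∈S i∉S
  bit-reflects S T i () i∈S | yes _ | no _

  -- Packs the `k` membership bits into one of `2 ^ k` numbers, so that codes have a decidable,
  -- finite type.
  initialSegment : Pred ℕ 0ℓ → Fin (2 ^ k)
  initialSegment S = funToFin (bit S)

  initialSegment-⊆ : ∀ {S T} → Contains≥ T k →
    initialSegment S ≡ initialSegment T → S ⊆ T
  initialSegment-⊆ {S} {T} ≥k⇒∈T eq {x} x∈S with x <? k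
  ... | no  x≮k = ≥k⇒∈T (≮⇒≥ x≮k)
  ... | yes x<k = subst T x≡ (bit-reflects S T i bits (subst S (sym x≡) x∈S))
    where
    i = fromℕ< x<k
    x≡ : toℕ i ≡ x
    x≡ = toℕ-fromℕ< x<k
    bits : bit S i ≡ bit T i
    -- Decoding is a pointwise inverse of `funToFin`, which avoids function extensionality.
    bits = trans (sym (finToFun-funToFin (bit S) i))
             (trans (cong (λ j → finToFun j i) eq) (finToFun-funToFin (bit T) i))

-- Such sets can differ only below `k`, so at most `2 ^ k` of them are distinct.
contains≥⇒finite : ExcludedMiddle (lsuc 0ℓ) → {P : Pred (Pred ℕ 0ℓ) 0ℓ} → ∀ k →
  (∀ {S} → P S → Contains≥ S k) → Finite (≐-setoid ℕ 0ℓ) P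
contains≥⇒finite em k ≥k⇒∈ =
  injectiveCode⇒finite em (≐-setoid ℕ 0ℓ) (initialSegment em₀ k ∘ proj₁)
    (λ (S , S∈P) (T , T∈P) eq →
      initialSegment-⊆ em₀ k (≥k⇒∈ T∈P) eq , initialSegment-⊆ em₀ k (≥k⇒∈ S∈P) (sym eq))
    (allFin (2 ^ k)) (λ _ → ∈-allFin _)
  where em₀ = lower-em em

-- Submonoids whose elements have gcd 1

module _ {S : Pred ℕ p} (isSubmonoid : IsSubmonoid S) where
  open IsSubmonoid isSubmonoid

  *-closed : ∀ m {x} → x ∈ S → m * x ∈ S
  *-closed zero    x∈S = 0∈S
  *-closed (suc m) x∈S = +-closed x∈S (*-closed m x∈S)

  -- Write `x = r + q * y` with `r < y`. From `y * y ≤ x` follows `y ≤ q`, hence `r ≤ q`, and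
  -- `x = r * suc y + (q ∸ r) * y`.
  consecutive⇒contains≥ : ∀ y .{{_ : NonZero y}} → y ∈ S → suc y ∈ S →
    Contains≥ S (y * y)
  consecutive⇒contains≥ y y∈S 1+y∈S {x} y*y≤x = subst S (sym x≡)
    (+-closed (*-closed (x % y) 1+y∈S) (*-closed (x / y ∸ x % y) y∈S))
    where
    r≤q : x % y ≤ x / y
    r≤q = ≤-trans (<⇒≤ (m%n<n x y))
            (subst (_≤ x / y) (m*n/n≡m y y) (/-monoˡ-≤ y y*y≤x))
    regroup : ∀ r t y → r + (r + t) * y ≡ r * suc y + t * y
    regroup = solve-∀
    x≡ : x ≡ x % y * suc y + (x / y ∸ x % y) * y
    x≡ = begin
      x                                     ≡⟨ m≡m%n+[m/n]*n x y ⟩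
      x % y + x / y * y                     ≡⟨ cong (λ t → x % y + t * y) (m+[n∸m]≡n r≤q) ⟨
      x % y + (x % y + (x / y ∸ x % y)) * y ≡⟨ regroup (x % y) (x / y ∸ x % y) y ⟩
      x % y * suc y + (x / y ∸ x % y) * y   ∎
      where open ≡-Reasoning

  -- The non-negative part of the subgroup of the integers generated by `S`, phrased without
  -- subtraction.
  Difference : Pred ℕ p
  Difference d = ∃ λ y → y ∈ S × y + d ∈ S

  ∈⇒difference : S ⊆ Difference
  ∈⇒difference x∈S = 0 , 0∈S , x∈S

  difference-* : ∀ m {d} → Difference d → Difference (m * d)
  difference-* m {d} (y , y∈S , y+d∈S) =
    m * y , *-closed m y∈S , subst S (*-distribˡ-+ m y d) (*-closed m y+d∈S)

  -- Adding the two pairs crosswise makes `d` occur on both sides, which leaves a gap of `r`.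
  difference-cancel : ∀ r d → Difference (r + d) → Difference d → Difference r
  difference-cancel r d (y , y∈S , y+[r+d]∈S) (z , z∈S , z+d∈S) =
    y + (z + d) , +-closed y∈S z+d∈S , subst S (regroup y z r d) (+-closed y+[r+d]∈S z∈S)
    where
    regroup : ∀ y z r d → y + (r + d) + z ≡ y + (z + d) + r
    regroup = solve-∀

  module _ (em : ExcludedMiddle p) (gcd≡1 : ∀ {d} → (∀ {x} → x ∈ S → d ∣ x) → d ∣ 1)
    where

    difference-1 : ∀ {d} → Acc _<_ d → d > 0 → Difference d → Difference 1
    difference-1 {d} (acc smaller) d>0 Δd with em {∃ λ x → x ∈ S × ¬ (d ∣ x)}
    ... | no ∄x = subst Difference (∣1⇒≡1 (gcd≡1 λ {x} x∈S → divides-all x x∈S)) Δd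
      where
      divides-all : ∀ x → x ∈ S → d ∣ x
      divides-all x x∈S with d ∣? x
      ... | yes d∣x = d∣x
      ... | no  d∤x = ⊥-elim (∄x (x , x∈S , d∤x))
    ... | yes (x , x∈S , d∤x) = difference-1 (smaller (m%n<n x d)) x%d>0
      -- Both `x` and its part `x / d * d` are differences, hence so is the remainder, which is
      -- below `d` and nonzero.
      (difference-cancel (x % d) (x / d * d)
        (subst Difference (m≡m%n+[m/n]*n x d) (∈⇒difference x∈S))
        (difference-* (x / d) Δd))
      where
      instance
        d≢0 : NonZero d
        d≢0 = >-nonZero d>0
      x%d>0 : x % d > 0
      x%d>0 = n≢0⇒n>0 (d∤x ∘ m%n≡0⇒n∣m x d)

    gcd≡1⇒contains≥ : ∀ {x} → x > 0 → x ∈ S → ∃ (Contains≥ S)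
    gcd≡1⇒contains≥ {x} x>0 x∈S with difference-1 (<-wellFounded x) x>0 (∈⇒difference x∈S)
    ... | y , y∈S , y+1∈S =
      -- y itself may be 0; y + (y + 1) is not.
      _ , consecutive⇒contains≥ (suc (y + y))
            (subst S (odd y) (+-closed y∈S y+1∈S)) (subst S (even y) (+-closed y+1∈S y+1∈S))
      where
      odd : ∀ y → y + (y + 1) ≡ suc (y + y)
      odd = solve-∀
      even : ∀ y → y + 1 + (y + 1) ≡ suc (suc (y + y))
      even = solve-∀

-- The intersection `M` and the members of `𝒩`

module _ {n : ℕ} {a b : Vector ℕ n} {X : Pred ℕ 0ℓ} where

  M-isSubmonoid : IsSubmonoid (M a b X)
  M-isSubmonoid = record
    { 0∈S      = λ (_ , S∈𝒩) → 0∈S (submonoid S∈𝒩)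
    ; +-closed = λ x∈M y∈M S∈𝒩 → +-closed (submonoid (proj₂ S∈𝒩)) (x∈M S∈𝒩) (y∈M S∈𝒩)
    }
    where
    open IsSubmonoid
    submonoid : ∀ {S} → 𝒩 a b X S → IsSubmonoid S
    submonoid = IsNumericalSemigroup.isSubmonoid ∘ 𝒩.isNumericalSemigroup

  X⊆M : X ⊆ M a b X
  X⊆M x∈X (_ , S∈𝒩) = 𝒩.X⊆S S∈𝒩 x∈X

  M-affine-closed : ∀ s → s ∈ M a b X ∖ ｛ 0 ｝ → All (M a b X) (affine a b s)
  M-affine-closed s (s∈M , s≢0) i (S , S∈𝒩) =
    𝒩.affine-closed S∈𝒩 s (s∈M (S , S∈𝒩) , s≢0) i

  M-isNumericalSemigroup : ExcludedMiddle (lsuc 0ℓ) → ∃ (Contains≥ (M a b X)) →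
    IsNumericalSemigroup (M a b X)
  M-isNumericalSemigroup em (_ , ≥k⇒∈M) = record
    { isSubmonoid      = M-isSubmonoid
    ; finiteComplement = contains≥⇒finiteComplement em ≥k⇒∈M
    }

  finite⇒M-contains≥ : ExcludedMiddle 0ℓ → 𝒩-Finite a b X → ∃ (Contains≥ (M a b X))
  finite⇒M-contains≥ em₀ (Ss , complete) =
    -- The sum dominates the threshold of each listed member, and every member has the same elements
    -- as a listed one.
    sum (map (proj₁ ∘ bound) Ss) , λ k≤x S∈𝒩 →
      let (T , T∈Ss , S≐T) = find (complete S∈𝒩)
      in proj₂ S≐T (proj₂ (bound T) (≤-trans (∈⇒≤sum (∈-map⁺ (proj₁ ∘ bound) T∈Ss)) k≤x))
    where
    bound : (S : ∃ (𝒩 a b X)) → ∃ (Contains≥ (proj₁ S))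
    bound (_ , S∈𝒩) = finiteComplement⇒contains≥ em₀
      (IsNumericalSemigroup.finiteComplement (𝒩.isNumericalSemigroup S∈𝒩))

  multiples∪large∈𝒩 : ExcludedMiddle 0ℓ → All (_> 0) a →
    ∀ {d} → (∀ {x} → x ∈ X ∪ entries b → d ∣ x) →
    ∀ k → 𝒩 a b X ((d ∣_) ∪ (k ≤_))
  multiples∪large∈𝒩 em₀ a>0 {d} d∣ k = record
    { isNumericalSemigroup = record
      { isSubmonoid = record
        { 0∈S      = inj₁ (d ∣0)
        ; +-closed = closed
        }
      ; finiteComplement = contains≥⇒finiteComplement em₀ {k = k} inj₂
      }
    ; X⊆S           = λ x∈X → inj₁ (d∣ (inj₁ x∈X))
    ; affine-closed = λ where
        s (inj₁ d∣s , _) i → inj₁ (∣m∣n⇒∣m+n (∣n⇒∣m*n (a i) d∣s) (d∣ (inj₂ (i , refl))))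
        -- Positivity of `a i` gives `s ≤ a i * s`, so the image stays at or above `k`.
        s (inj₂ k≤s , _) i → inj₂ (m≤n⇒m≤n+o (b i)
          (≤-trans k≤s (m≤n*m s (a i) {{>-nonZero (a>0 i)}})))
    }
    where
    closed : ∀ {x y} → x ∈ (d ∣_) ∪ (k ≤_) → y ∈ (d ∣_) ∪ (k ≤_) → x + y ∈ (d ∣_) ∪ (k ≤_)
    closed         (inj₁ d∣x) (inj₁ d∣y) = inj₁ (∣m∣n⇒∣m+n d∣x d∣y)
    closed {x}     (inj₁ _)   (inj₂ k≤y) = inj₂ (m≤n⇒m≤o+n x k≤y)
    closed {y = y} (inj₂ k≤x) _          = inj₂ (m≤n⇒m≤n+o y k≤x)

  M⊆multiples : ExcludedMiddle 0ℓ → All (_> 0) a →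
    ∀ {d} → (∀ {x} → x ∈ X ∪ entries b → d ∣ x) → M a b X ⊆ (d ∣_)
  M⊆multiples em₀ a>0 d∣ {x} x∈M with x∈M (_ , multiples∪large∈𝒩 em₀ a>0 d∣ (suc x))
  -- The threshold `suc x` keeps `x` out of the large part, so only divisibility remains.
  ... | inj₁ d∣x = d∣x
  ... | inj₂ x<x = ⊥-elim (<-irrefl refl x<x)

  M-contains≥⇒gcd≡1 : ExcludedMiddle 0ℓ → All (_> 0) a → ∃ (Contains≥ (M a b X)) →
    IsGCD (X ∪ entries b) 1
  M-contains≥⇒gcd≡1 em₀ a>0 (k , ≥k⇒∈M) = record
    { commonDivisor = λ {x} _ → 1∣ x
    -- Both `k` and `k + 1` lie in `M`, so a common divisor divides each and therefore 1.
    ; greatest      = λ d∣ → ∣m+n∣m⇒∣n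
        (M⊆multiples em₀ a>0 d∣ (≥k⇒∈M (m≤m+n k 1)))
        (M⊆multiples em₀ a>0 d∣ (≥k⇒∈M ≤-refl))
    }

  -- One nonzero `x` in `X` serves twice: affine closure at `x` brings in the entries of `b`, and
  -- `x` is the positive difference from which the descent starts.
  gcd≡1⇒M-contains≥ : ExcludedMiddle (lsuc 0ℓ) → Satisfiable X → 0 ∉ X →
    IsGCD (X ∪ entries b) 1 → ∃ (Contains≥ (M a b X))
  gcd≡1⇒M-contains≥ em (x , x∈X) 0∉X gcd =
    gcd≡1⇒contains≥ M-isSubmonoid em
      (λ d∣M → IsGCD.greatest gcd λ where
        (inj₁ y∈X)        → d∣M (X⊆M y∈X)
        (inj₂ (i , refl)) → ∣m+n∣m⇒∣n
          (d∣M (M-affine-closed x (X⊆M x∈X , x≢0 ∘ sym) i))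
          (∣n⇒∣m*n (a i) (d∣M (X⊆M x∈X))))
      (n≢0⇒n>0 x≢0) (X⊆M x∈X)
    where
    x≢0 : x ≢ 0
    x≢0 refl = 0∉X x∈X

theorem2p6 : ExcludedMiddle (lsuc 0ℓ) →
    (n : ℕ) → n ≥ 1 →
    (a b : Vector ℕ n) → All (_> 0) a → All (_> 0) b →
    (X : Pred ℕ 0ℓ) → Satisfiable X → 0 ∉ X →
    (𝒩-Finite a b X ⇔ IsNumericalSemigroup (M a b X))
    × (IsNumericalSemigroup (M a b X) ⇔ IsGCD (X ∪ entries b) 1)
theorem2p6 em n _ a b a>0 _ X X≢∅ 0∉X =
    mk⇔ (λ 𝒩-finite → M-isNumericalSemigroup em (finite⇒M-contains≥ em₀ 𝒩-finite))
        -- Every member contains `M`, so a threshold of `M` holds for all members uniformly.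
        (λ M-num → let (k , ≥k⇒∈M) = M-contains≥ M-num in
          contains≥⇒finite em k λ S∈𝒩 k≤x → ≥k⇒∈M k≤x (_ , S∈𝒩))
  , mk⇔ (M-contains≥⇒gcd≡1 em₀ a>0 ∘ M-contains≥)
        (M-isNumericalSemigroup em ∘ gcd≡1⇒M-contains≥ em X≢∅ 0∉X)
  where
  em₀ = lower-em em
  M-contains≥ : IsNumericalSemigroup (M a b X) → ∃ (Contains≥ (M a b X))
  M-contains≥ = finiteComplement⇒contains≥ em ∘ IsNumericalSemigroup.finiteComplement
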